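{- Let $T$ be a tree rooted at a vertex $r$, and let $x_1,\dots,x_t$ be the vertices of height one (non-root vertices all of whose children are leaves and which have at least one child). For each $i$, let $v_i$ be the non-leaf neighbor (parent) of $x_i$, let $k_i$ be the number of leaves adjacent to $v_i$, and let $r_i$ be the number of leaves adjacent to $x_i$. (1) If $k_i\ge1$ and $r_i\ge2$ for some $i$, then $b_{tR}(T)=1$. (2) If $k_i\ge 2$ and $r_i=1$ for some $i$, then $b_{tR}(T)\le \deg(v_i)-k_i$. (3) For integers $t\ge3$ and $2\le k\le t-1$, $b_{tR}(S(k,t))=t-k$.
   Context: A TRDF on $G=(V,E)$ is a function $f:V\to\{0,1,2\}$ such that every $v$ with $f(v)=0$ has a neighbor $u$ with $f(u)=2$ and the subgraph induced by $\{v:f(v)>0\}$ has no isolated vertices; $\gamma_{tR}(G)$ is its minimum weight. $b_{tR}(G)$ is the minimum $|E'|$ such that $G-E'$ has no isolated vertices and $\gamma_{tR}(G-E')>\gamma_{tR}(G)$ ($\infty$ if none). In a rooted tree, the height of a vertex $x$ is the length of a longest path from $x$ down to a leaf descendant. For $t\ge 2$, $k\ge1$, the wounded spider $S(k,t)$ is the star $K_{1,t}$ with $t-k$ of its edges subdivided once. -}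

module Defs where

open import Algebra.Properties.CommutativeMonoid.Sum using (sum)
open import Data.Bool using (Bool; true; false; _∧_; not; T)
open import Data.Fin using (Fin; zero; suc; toℕ; splitAt)
open import Data.Fin.Subset using (Subset; ∣_∣)
open import Data.List using (List; []; _∷_; length)
open import Data.List.Relation.Unary.Unique.Propositional using (Unique)
open import Data.Nat using (ℕ; suc; _+_; _∸_; _≤_; _<_; _≡ᵇ_; _<ᵇ_)
open import Data.Nat.Properties using (+-0-commutativeMonoid)
open import Data.Product using (Σ-syntax; ∃-syntax; _×_)
open import Data.Sum using ([_,_]′)
open import Data.Vec using (tabulate)
open import Function using (_∘_)
open import Relation.Binary.Construct.Closure.ReflexiveTransitive using (Star; ε; _◅_)
open import Relation.Binary.PropositionalEquality using (_≡_; _≢_; refl; cong₂; cong)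
open import Relation.Nullary using (¬_)
open import Relation.Nullary.Construct.Add.Supremum using (_⁺; [_]; ⊤⁺)

∑ : ∀ {n} → (Fin n → ℕ) → ℕ
∑ = sum +-0-commutativeMonoid

IsLeast : (ℕ → Set) → ℕ → Set
IsLeast P m = P m × (∀ k → P k → m ≤ k)

record Graph (n : ℕ) : Set where
  field
    adj        : Fin n → Fin n → Bool
    adj-sym    : ∀ u v → adj u v ≡ adj v u
    adj-irrefl : ∀ v → adj v v ≡ false

open Graph public

module _ {n : ℕ} (G : Graph n) where

  Adj : Fin n → Fin n → Set
  Adj u v = T (adj G u v)

  neighbours : Fin n → Subset n
  neighbours v = tabulate (adj G v)

  deg : Fin n → ℕ
  deg v = ∣ neighbours v ∣

  Leaf : Fin n → Set
  Leaf v = deg v ≡ 1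

  leavesAt : Fin n → ℕ
  leavesAt v = ∣ tabulate (λ u → adj G v u ∧ (deg u ≡ᵇ 1)) ∣

  NoIsolated : Set
  NoIsolated = ∀ v → ∃[ u ] Adj v u

  -- Each edge {u , v} is counted once, at the ordered pair with u < v.
  size : ℕ
  size = ∑ λ u → ∣ tabulate (λ v → (toℕ u <ᵇ toℕ v) ∧ adj G u v) ∣

  Walk : Fin n → Fin n → Set
  Walk = Star Adj

  vertices : ∀ {u v} → Walk u v → List (Fin n)
  vertices {u} ε       = u ∷ []
  vertices {u} (_ ◅ w) = u ∷ vertices w

  IsPath : ∀ {u v} → Walk u v → Set
  IsPath w = Unique (vertices w)

  Connected : Set
  Connected = ∀ u v → Walk u v

  -- A cycle is a path on at least three vertices whose ends are adjacent.
  HasCycle : Set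
  HasCycle = ∃[ u ] ∃[ v ] Σ[ w ∈ Walk u v ]
    (IsPath w × 3 ≤ length (vertices w) × Adj v u)

  IsTree : Set
  IsTree = Connected × ¬ HasCycle

  -- In the tree rooted at r, p is the parent of x: the path from x to the
  -- root starts with the edge x p.
  Parent : (r p x : Fin n) → Set
  Parent r p x = Σ[ e ∈ Adj x p ] Σ[ w ∈ Walk p r ] IsPath (e ◅ w)

  HeightOne : (r x : Fin n) → Set
  HeightOne r x =
    x ≢ r × (∃[ c ] Parent r x c) × (∀ c → Parent r x c → Leaf c)

  Labelling : Set
  Labelling = Fin n → Fin 3

  weight : Labelling → ℕ
  weight f = ∑ (toℕ ∘ f)

  -- The second component says that the subgraph induced by {v : f v > 0} has
  -- no isolated vertices.
  IsTRDF : Labelling → Set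
  IsTRDF f =
    (∀ v → toℕ (f v) ≡ 0 → ∃[ u ] (Adj v u × toℕ (f u) ≡ 2)) ×
    (∀ v → 0 < toℕ (f v) → ∃[ u ] (Adj v u × 0 < toℕ (f u)))

  -- γtR(G) = m, as a relation: a graph with an isolated vertex has no TRDF,
  -- hence no value.
  γtR≡ : ℕ → Set
  γtR≡ = IsLeast λ m → ∃[ f ] (IsTRDF f × weight f ≡ m)

-- A set E′ of edges of G is represented by the spanning subgraph with edge
-- set E′, so that ∣E′∣ is its size.
_⊆ₑ_ : ∀ {n} → Graph n → Graph n → Set
E′ ⊆ₑ G = ∀ u v → Adj E′ u v → Adj G u v

_−_ : ∀ {n} → Graph n → Graph n → Graph n
adj        (G − E′) u v = adj G u v ∧ not (adj E′ u v)
adj-sym    (G − E′) u v = cong₂ (λ a b → a ∧ not b) (adj-sym G u v) (adj-sym E′ u v)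
adj-irrefl (G − E′) v   = cong (_∧ not (adj E′ v v)) (adj-irrefl G v)

module _ {n : ℕ} (G : Graph n) where

  Raises-γtR : Graph n → Set
  Raises-γtR E′ = E′ ⊆ₑ G × NoIsolated (G − E′) ×
    ∃[ m ] ∃[ m′ ] (γtR≡ G m × γtR≡ (G − E′) m′ × m < m′)

  -- btR(G) = b, where b ∈ ℕ ∪ {∞} and ⊤⁺ is ∞.
  btR≡ : ℕ ⁺ → Set
  btR≡ [ b ] = IsLeast (λ m → ∃[ E′ ] (Raises-γtR E′ × size E′ ≡ m)) b
  btR≡ ⊤⁺    = ∀ E′ → ¬ Raises-γtR E′

-- K₁,ₜ with the edges from the centre to its first s leaves subdivided:
-- `end i` are the leaves of the star, `mid j` subdivides the edge
-- {centre , end j}.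
data SpiderVertex (t s : ℕ) : Set where
  centre : SpiderVertex t s
  end    : Fin t → SpiderVertex t s
  mid    : Fin s → SpiderVertex t s

spiderVertex : ∀ t s → Fin (suc (t + s)) → SpiderVertex t s
spiderVertex t s zero    = centre
spiderVertex t s (suc i) = [ end , mid ]′ (splitAt t i)

spiderAdj : ∀ {t s} → SpiderVertex t s → SpiderVertex t s → Bool
spiderAdj         centre  centre  = false
spiderAdj {s = s} centre  (end i) = not (toℕ i <ᵇ s)
spiderAdj         centre  (mid _) = true
spiderAdj {s = s} (end i) centre  = not (toℕ i <ᵇ s)
spiderAdj         (end _) (end _) = false
spiderAdj         (end i) (mid j) = toℕ i ≡ᵇ toℕ j
spiderAdj         (mid _) centre  = true
spiderAdj         (mid j) (end i) = toℕ i ≡ᵇ toℕ j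
spiderAdj         (mid _) (mid _) = false

spiderAdj-sym : ∀ {t s} (x y : SpiderVertex t s) → spiderAdj x y ≡ spiderAdj y x
spiderAdj-sym centre  centre  = refl
spiderAdj-sym centre  (end _) = refl
spiderAdj-sym centre  (mid _) = refl
spiderAdj-sym (end _) centre  = refl
spiderAdj-sym (end _) (end _) = refl
spiderAdj-sym (end _) (mid _) = refl
spiderAdj-sym (mid _) centre  = refl
spiderAdj-sym (mid _) (end _) = refl
spiderAdj-sym (mid _) (mid _) = refl

spiderAdj-irrefl : ∀ {t s} (x : SpiderVertex t s) → spiderAdj x x ≡ false
spiderAdj-irrefl centre  = refl
spiderAdj-irrefl (end _) = refl
spiderAdj-irrefl (mid _) = refl

-- The wounded spider S(k , t); meaningful for k ≤ t.
S : ∀ k t → Graph (suc (t + (t ∸ k)))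
adj        (S k t) u v =
  spiderAdj (spiderVertex t (t ∸ k) u) (spiderVertex t (t ∸ k) v)
adj-sym    (S k t) u v =
  spiderAdj-sym (spiderVertex t (t ∸ k) u) (spiderVertex t (t ∸ k) v)
adj-irrefl (S k t) v   = spiderAdj-irrefl (spiderVertex t (t ∸ k) v)

{-# OPTIONS --safe #-}
-- All three parts delete the edges joining a vertex w to its non-pendant
-- neighbours, where w has at least two pendant neighbours and some deleted edge
-- leads to a support vertex z.  Then w is the centre of a star component, on
-- which every TRDF weighs at least 3, whereas with the edge w z present it is
-- enough to label w by 2 and its leaves by 0, since z always has a positive
-- label.  Hence the deletion raises γtR.  In the tree of (1) w = x and z = v,
-- in (2) w = v and z = x, and in (3) w is the centre of the spider.
--
-- For the lower bound in (3), pendant edges cannot be deleted, so an edge set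
-- smaller than t − k leaves the centre adjacent to a subdivision vertex, and the
-- minimum TRDF of the spider survives.
module Submission where

open import Defs
open import Algebra.Properties.CommutativeMonoid.Sum using (sum-cong-≗; sum-replicate-zero; ∑-distrib-+)
open import Algebra.Properties.Semiring.Sum using (*-distribˡ-sum)
open import Data.Bool using (Bool; true; false; if_then_else_; T; _∧_; _∨_; not)
open import Data.Bool.Properties using (T?; T-∧; T-∨; ∨-comm; ∨-identityʳ; ∧-zeroʳ)
open import Data.Empty using (⊥-elim)
open import Data.Fin using (Fin; zero; suc; toℕ; _≟_; _↑ˡ_; _↑ʳ_; splitAt; fromℕ<)
open import Data.Fin.Properties using (any?; all?; toℕ<n; toℕ-injective; toℕ-↑ˡ; toℕ-↑ʳ; toℕ-fromℕ<; ↑ʳ-injective; splitAt-↑ˡ; splitAt-↑ʳ; join-splitAt)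
open import Data.Fin.Subset using (∣_∣)
open import Data.List using (length)
open import Data.List.Membership.Propositional using (_∈_)
open import Data.List.Relation.Unary.All as All using (All; []; _∷_)
open import Data.List.Relation.Unary.AllPairs using ([]; _∷_)
open import Data.List.Relation.Unary.Any using (here; there)
open import Data.Nat using (ℕ; zero; suc; _+_; _*_; _∸_; _≤_; _<_; z≤n; s≤s; _<ᵇ_; _≡ᵇ_; _<?_)
open import Data.Nat.Induction using (<-wellFounded; Acc; acc)
open import Data.Nat.Properties using (+-0-commutativeMonoid; +-*-semiring; ≤-refl; ≤-trans; ≤-reflexive; ≤-antisym; +-mono-≤; +-suc; +-comm; +-assoc; +-identityʳ; *-identityˡ; *-identityʳ; ≮⇒≥; m≤n⇒m≤1+n; ≤⇒≯; +-cancelʳ-≤; m≤m+n; <⇒≱; <⇒≢; n≢0⇒n>0; anyUpTo?; m+n∸n≡m; m∸n+n≡m; m<n⇒0<n∸m; <⇒<ᵇ; <ᵇ⇒<; ≡ᵇ⇒≡; ≡⇒≡ᵇ; m≤n+m; module ≤-Reasoning)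
  renaming (_≟_ to _≟ℕ_)
open import Data.Nat.Tactic.RingSolver using (solve-∀)
open import Data.Product using (∃; ∃-syntax; Σ-syntax; _×_; _,_; proj₁; proj₂)
open import Data.Sum using (_⊎_; inj₁; inj₂; [_,_]′)
open import Data.Unit using (tt)
open import Data.Vec using (tabulate)
open import Function using (_∘_; id; Equivalence)
open import Level using (0ℓ)
open import Relation.Binary using (Rel; Reflexive)
open import Relation.Binary.Construct.Add.Supremum.NonStrict _≤_ using (_≤⁺_; [_])
open import Relation.Binary.Construct.Closure.ReflexiveTransitive using (ε; _◅_)
open import Relation.Binary.PropositionalEquality using (_≡_; _≢_; _≗_; refl; sym; trans; cong; cong₂; subst; module ≡-Reasoning)
open import Relation.Nullary using (¬_; Dec; yes; no; does; contradiction)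
open import Relation.Nullary.Construct.Add.Supremum using ([_])
open import Relation.Nullary.Decidable using (map′; _×-dec_; _→-dec_; ¬?; decidable-stable; dec-true; dec-false)
open import Relation.Unary using (Decidable)

private
  variable
    n : ℕ

-- Sums and cardinalities

∑-cong : {f g : Fin n → ℕ} → f ≗ g → ∑ f ≡ ∑ g
∑-cong = sum-cong-≗ +-0-commutativeMonoid

∑-+ : (f g : Fin n → ℕ) → ∑ (λ u → f u + g u) ≡ ∑ f + ∑ g
∑-+ = ∑-distrib-+ +-0-commutativeMonoid

∑-zero : ∀ n → ∑ {n} (λ _ → 0) ≡ 0
∑-zero = sum-replicate-zero +-0-commutativeMonoid

∑-one : ∀ n → ∑ {n} (λ _ → 1) ≡ n
∑-one zero    = refl
∑-one (suc n) = cong suc (∑-one n)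

∑-mono : {f g : Fin n → ℕ} → (∀ u → f u ≤ g u) → ∑ f ≤ ∑ g
∑-mono {zero}  f≤g = z≤n
∑-mono {suc n} f≤g = +-mono-≤ (f≤g zero) (∑-mono (f≤g ∘ suc))

term≤∑ : (f : Fin n → ℕ) → ∀ u → f u ≤ ∑ f
term≤∑ f zero    = ≤-trans (≤-reflexive (sym (+-identityʳ _))) (+-mono-≤ (≤-refl {f zero}) z≤n)
term≤∑ f (suc u) = ≤-trans (term≤∑ (f ∘ suc) u) (m≤n+m _ (f zero))

∑-splitAt : ∀ m (f : Fin (m + n) → ℕ) → ∑ f ≡ ∑ (f ∘ (_↑ˡ n)) + ∑ (f ∘ (m ↑ʳ_))
∑-splitAt zero    f = refl
∑-splitAt (suc m) f =
  trans (cong (f zero +_) (∑-splitAt m (f ∘ suc))) (sym (+-assoc (f zero) _ _))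

⟦_⟧ : Bool → ℕ
⟦ true ⟧  = 1
⟦ false ⟧ = 0

⟦⟧-mono : ∀ {a b} → (T a → T b) → ⟦ a ⟧ ≤ ⟦ b ⟧
⟦⟧-mono {false}         _ = z≤n
⟦⟧-mono {true}  {true}  _ = ≤-refl
⟦⟧-mono {true}  {false} h = ⊥-elim (h tt)

⟦⟧≡1 : ∀ {a} → T a → ⟦ a ⟧ ≡ 1
⟦⟧≡1 {true} _ = refl

∣tabulate∣ : (B : Fin n → Bool) → ∣ tabulate B ∣ ≡ ∑ (⟦_⟧ ∘ B)
∣tabulate∣ {zero}  B = refl
∣tabulate∣ {suc n} B with B zero
... | true  = cong suc (∣tabulate∣ (B ∘ suc))
... | false = ∣tabulate∣ (B ∘ suc)

-- The Kronecker delta, built on the Boolean that `starAt` tests too, so that one case split on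
-- `a ≟ u` evaluates both.
δ : Fin n → Fin n → ℕ
δ a u = ⟦ does (a ≟ u) ⟧

≟⇒≡ : {a u : Fin n} → T (does (a ≟ u)) → a ≡ u
≟⇒≡ {a = a} {u} t with a ≟ u
... | yes a≡u = a≡u

≡⇒≟ : {a u : Fin n} → a ≡ u → T (does (a ≟ u))
≡⇒≟ {a = a} {u} a≡u = subst T (sym (dec-true (a ≟ u) a≡u)) tt

∑-δ* : (a : Fin n) (g : Fin n → ℕ) → ∑ (λ u → δ a u * g u) ≡ g a
∑-δ* {suc n} zero g = trans (cong₂ _+_ (*-identityˡ (g zero)) (∑-zero n)) (+-identityʳ _)
-- The term at `zero` vanishes by computation, and `does (suc a ≟ suc u)` reduces to `does (a ≟ u)`.
∑-δ* (suc a)      g = ∑-δ* a (g ∘ suc)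

∑-δ : (a : Fin n) → ∑ (δ a) ≡ 1
∑-δ a = trans (∑-cong (λ u → sym (*-identityʳ (δ a u)))) (∑-δ* a (λ _ → 1))

module _ (B : Fin n → Bool) where

  ∣∣≤∑ : (g : Fin n → ℕ) → (∀ u → T (B u) → 1 ≤ g u) → ∣ tabulate B ∣ ≤ ∑ g
  ∣∣≤∑ g h = ≤-trans (≤-reflexive (∣tabulate∣ B)) (∑-mono pointwise)
    where
    pointwise : ∀ u → ⟦ B u ⟧ ≤ g u
    pointwise u with B u | h u
    ... | true  | 1≤g = 1≤g tt
    ... | false | _   = z≤n

  ∑≤∣∣ : (g : Fin n → ℕ) → (∀ u → g u ≤ ⟦ B u ⟧) → ∑ g ≤ ∣ tabulate B ∣
  ∑≤∣∣ g h = ≤-trans (∑-mono h) (≤-reflexive (sym (∣tabulate∣ B)))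

  member : 1 ≤ ∣ tabulate B ∣ → ∃[ a ] T (B a)
  member 1≤ with any? (λ a → T? (B a))
  ... | yes p = p
  ... | no ¬p = contradiction
    (≤-trans 1≤ (≤-trans (∣∣≤∑ (λ _ → 0) (λ u Bu → ⊥-elim (¬p (u , Bu)))) (≤-reflexive (∑-zero n))))
    λ ()

  unique⇒∣∣≤1 : ∀ a → (∀ u → T (B u) → a ≡ u) → ∣ tabulate B ∣ ≤ 1
  unique⇒∣∣≤1 a h = ≤-trans (∣∣≤∑ (δ a) (λ u Bu → ≤-reflexive (sym (⟦⟧≡1 (≡⇒≟ (h u Bu)))))) (≤-reflexive (∑-δ a))

  member⇒1≤∣∣ : ∀ {a} → T (B a) → 1 ≤ ∣ tabulate B ∣
  member⇒1≤∣∣ {a} Ba = ≤-trans (≤-reflexive (sym (∑-δ a))) (∑≤∣∣ (δ a) pointwise)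
    where
    pointwise : ∀ u → δ a u ≤ ⟦ B u ⟧
    pointwise u with a ≟ u
    ... | yes refl = ≤-reflexive (sym (⟦⟧≡1 Ba))
    ... | no _     = z≤n

  -- Since `a` and `b` differ, `δ a + δ b` stays below the indicator of `B`, and it sums to 2.
  two-members⇒2≤∣∣ : ∀ {a b} → a ≢ b → T (B a) → T (B b) → 2 ≤ ∣ tabulate B ∣
  two-members⇒2≤∣∣ {a} {b} a≢b Ba Bb =
    ≤-trans (≤-reflexive (sym (trans (∑-+ (δ a) (δ b)) (cong₂ _+_ (∑-δ a) (∑-δ b)))))
            (∑≤∣∣ (λ u → δ a u + δ b u) pointwise)
    where
    pointwise : ∀ u → δ a u + δ b u ≤ ⟦ B u ⟧
    pointwise u with a ≟ u | b ≟ u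
    ... | yes refl | yes refl = contradiction refl a≢b
    ... | yes refl | no _     = ≤-reflexive (sym (⟦⟧≡1 Ba))
    ... | no _     | yes refl = ≤-reflexive (sym (⟦⟧≡1 Bb))
    ... | no _     | no _     = z≤n

  two-members : 2 ≤ ∣ tabulate B ∣ → ∃[ a ] ∃[ b ] (a ≢ b × T (B a) × T (B b))
  two-members 2≤ with member (≤-trans (s≤s z≤n) 2≤)
  ... | a , Ba with any? (λ b → ¬? (a ≟ b) ×-dec T? (B b))
  ...   | yes (b , a≢b , Bb) = a , b , a≢b , Ba , Bb
  ...   | no ¬b = contradiction (unique⇒∣∣≤1 a unique) (<⇒≱ 2≤)
    where
    unique : ∀ u → T (B u) → a ≡ u
    unique u Bu = decidable-stable (a ≟ u) λ a≢u → ¬b (u , a≢u , Bu)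

-- Finite search

-- Only predicates invariant under `_≈_` are searched: without function extensionality, an
-- exhaustive list of functions is complete only up to pointwise equality.
Searchable : {A : Set} → Rel A 0ℓ → Set₁
Searchable {A} _≈_ = {P : A → Set} → (∀ {x y} → x ≈ y → P x → P y) → Decidable P → Dec (∃ P)

Fin-searchable : Searchable {Fin n} _≡_
Fin-searchable _ P? = any? P?

Bool-searchable : Searchable {Bool} _≡_
Bool-searchable _ P? with P? true | P? false
... | yes p | _     = yes (true , p)
... | no _  | yes p = yes (false , p)
... | no ¬p | no ¬q = no λ { (true , p) → ¬p p ; (false , q) → ¬q q }

[]ᶠ : {A : Set} → Fin 0 → A
[]ᶠ ()

infixr 5 _∷ᶠ_
_∷ᶠ_ : {A : Set} → A → (Fin n → A) → Fin (suc n) → A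
(a ∷ᶠ g) zero    = a
(a ∷ᶠ g) (suc i) = g i

-- A function on `Fin (suc n)` is a value at `zero` followed by a function on the rest, so the
-- search over `A` is nested around the search for the tail. As `f` agrees with its rebuilt form
-- only pointwise, `resp` carries the witness across.
→-searchable : {A : Set} {_≈_ : Rel A 0ℓ} → Reflexive _≈_ → Searchable _≈_ →
  ∀ n → Searchable {Fin n → A} (λ f g → ∀ i → f i ≈ g i)
→-searchable ≈-refl search zero resp P? =
  map′ (λ p → []ᶠ , p) (λ (_ , p) → resp (λ ()) p) (P? []ᶠ)
→-searchable {_≈_ = _≈_} ≈-refl search (suc n) {P} resp P? =
  map′ (λ (a , g , p) → a ∷ᶠ g , p)
       (λ (f , p) → f zero , f ∘ suc , resp (λ { zero → ≈-refl ; (suc i) → ≈-refl }) p)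
       (search (λ x≈y (g , p) → g , resp (λ { zero → x≈y ; (suc i) → ≈-refl }) p)
               (λ a → →-searchable ≈-refl search n
                        (λ f≈g → resp (λ { zero → ≈-refl ; (suc i) → f≈g i }))
                        (λ g → P? (a ∷ᶠ g))))

-- Descent: either nothing below `k` satisfies `P`, or the search restarts from a smaller witness.
-- The bound `m ≤ k` later turns one raising edge set into an upper bound on `btR`.
least : {P : ℕ → Set} → Decidable P → ∀ {k} → P k → ∃[ m ] (IsLeast P m × m ≤ k)
least {P} P? {k} = go k (<-wellFounded k)
  where
  go : ∀ k → Acc _<_ k → P k → ∃[ m ] (IsLeast P m × m ≤ k)
  go k (acc rec) Pk with anyUpTo? P? k
  ... | no ¬p = k , (Pk , λ j Pj → ≮⇒≥ λ j<k → ¬p (j , j<k , Pj)) , ≤-refl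
  ... | yes (j , j<k , Pj) with go j (rec j<k) Pj
  ...   | m , m-least , m≤j = m , m-least , ≤-trans m≤j (≤-trans (m≤n+m j 1) j<k)

-- Total Roman domination

⊆ₑ-refl : (G : Graph n) → G ⊆ₑ G
⊆ₑ-refl G u v e = e

adj-flip : (G : Graph n) → ∀ {u v} → Adj G u v → Adj G v u
adj-flip G {u} {v} = subst T (adj-sym G u v)

adj⇒≢ : (G : Graph n) → ∀ {u v} → Adj G u v → u ≢ v
adj⇒≢ G {u} e refl = subst T (adj-irrefl G u) e

−-intro : (G E : Graph n) → ∀ {u v} → Adj G u v → ¬ Adj E u v → Adj (G − E) u v
−-intro G E {u} {v} e ¬e′ with adj G u v | adj E u v
... | true | false = tt
... | true | true  = ⊥-elim (¬e′ tt)

−-⊆ : (G E : Graph n) → (G − E) ⊆ₑ G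
−-⊆ G E u v = proj₁ ∘ Equivalence.to T-∧

−-avoids : (G E : Graph n) → ∀ {u v} → Adj (G − E) u v → ¬ Adj E u v
−-avoids G E {u} {v} e e′ with adj G u v | adj E u v
−-avoids G E () _ | true | true

−-antimono : (G E F : Graph n) → F ⊆ₑ E → (G − E) ⊆ₑ (G − F)
−-antimono G E F F⊆E u v e =
  −-intro G F (−-⊆ G E u v e) (−-avoids G E e ∘ F⊆E u v)

NoIsolated-mono : (H G : Graph n) → H ⊆ₑ G → NoIsolated H → NoIsolated G
NoIsolated-mono H G H⊆G iso v with iso v
... | u , e = u , H⊆G v u e

IsTRDF-mono : (H G : Graph n) → H ⊆ₑ G → ∀ {f} → IsTRDF H f → IsTRDF G f
IsTRDF-mono H G H⊆G (dom , tot) =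
  (λ v z → let u , e , p = dom v z in u , H⊆G v u e , p) ,
  (λ v z → let u , e , p = tot v z in u , H⊆G v u e , p)

IsTRDF-resp : (G : Graph n) → ∀ {f g} → f ≗ g → IsTRDF G f → IsTRDF G g
IsTRDF-resp G f≗g (dom , tot) =
  (λ v z → let u , e , p = dom v (trans (cong toℕ (f≗g v)) z)
           in u , e , trans (cong toℕ (sym (f≗g u))) p) ,
  (λ v z → let u , e , p = tot v (subst (λ l → 0 < toℕ l) (sym (f≗g v)) z)
           in u , e , subst (λ l → 0 < toℕ l) (f≗g u) p)

IsTRDF? : (G : Graph n) → Decidable (IsTRDF G)
IsTRDF? G f =
  all? (λ v → (toℕ (f v) ≟ℕ 0) →-dec any? (λ u → T? (adj G v u) ×-dec (toℕ (f u) ≟ℕ 2))) ×-dec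
  all? (λ v → (0 <? toℕ (f v)) →-dec any? (λ u → T? (adj G v u) ×-dec (0 <? toℕ (f u))))

TRDF-of-weight? : (G : Graph n) → Decidable (λ m → ∃[ f ] (IsTRDF G f × weight G f ≡ m))
TRDF-of-weight? {n} G m = →-searchable refl Fin-searchable n
  (λ f≗g (trdf , w) → IsTRDF-resp G f≗g trdf , trans (∑-cong (λ u → cong toℕ (sym (f≗g u)))) w)
  (λ f → IsTRDF? G f ×-dec (weight G f ≟ℕ m))

-- The labelling constantly 1 is a TRDF once no vertex is isolated, so some weight is attained and a
-- least one can be searched for.
γtR-exists : (G : Graph n) → NoIsolated G → ∃[ m ] γtR≡ G m
γtR-exists G iso with least (TRDF-of-weight? G) (f , trdf , refl)
  where
  f : Labelling G
  f _ = suc zero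
  trdf : IsTRDF G f
  trdf = (λ _ ()) , λ v _ → let u , e = iso v in u , e , s≤s z≤n
... | m , m-least , _ = m , m-least

γtR-mono : (H G : Graph n) → H ⊆ₑ G → ∀ {m m′} → γtR≡ G m → γtR≡ H m′ → m ≤ m′
γtR-mono H G H⊆G (_ , min) ((f , trdf , w) , _) = min _ (f , IsTRDF-mono H G H⊆G trdf , w)

-- Bondage

size≡∑ : (G : Graph n) → size G ≡ ∑ (λ u → ∑ (λ v → ⟦ (toℕ u <ᵇ toℕ v) ∧ adj G u v ⟧))
size≡∑ G = ∑-cong (λ u → ∣tabulate∣ (λ v → (toℕ u <ᵇ toℕ v) ∧ adj G u v))

size-mono : (H G : Graph n) → H ⊆ₑ G → size H ≤ size G
size-mono H G H⊆G = begin
  size H ≡⟨ size≡∑ H ⟩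
  _      ≤⟨ ∑-mono (λ u → ∑-mono (λ v → ⟦⟧-mono (λ e →
              let u<v , a = Equivalence.to T-∧ e in Equivalence.from T-∧ (u<v , H⊆G u v a)))) ⟩
  _      ≡⟨ size≡∑ G ⟨
  size G ∎
  where open ≤-Reasoning

-- Edge sets found by search match a given one only up to mutual inclusion, so raising is
-- transported along inclusions instead of equality.
Raises-resp : (G E F : Graph n) → E ⊆ₑ F → F ⊆ₑ E → Raises-γtR G E → Raises-γtR G F
Raises-resp G E F E⊆F F⊆E (E⊆G , iso , m , m′ , γ , γ′ , m<m′)
  with NoIsolated-mono (G − E) (G − F) (−-antimono G E F F⊆E) iso
... | iso′ with γtR-exists (G − F) iso′
...   | m″ , γ″ =
  (λ u v → E⊆G u v ∘ F⊆E u v) , iso′ , m , m″ , γ , γ″ ,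
  ≤-trans m<m′ (γtR-mono (G − F) (G − E) (−-antimono G F E E⊆F) γ′ γ″)

Raises? : (G E : Graph n) → Dec (Raises-γtR G E)
Raises? G E with all? (λ u → all? (λ v → T? (adj E u v) →-dec T? (adj G u v)))
                | all? (λ v → any? (λ u → T? (adj (G − E) v u)))
... | no ¬E⊆G | _       = no (¬E⊆G ∘ proj₁)
... | yes _   | no ¬iso = no (¬iso ∘ proj₁ ∘ proj₂)
... | yes E⊆G | yes iso
  with γtR-exists G (NoIsolated-mono (G − E) G (−-⊆ G E) iso) | γtR-exists (G − E) iso
...   | m , γ | m′ , γ′ = map′
  (λ m<m′ → E⊆G , iso , m , m′ , γ , γ′ , m<m′)
  -- The values in an arbitrary witness are compared with the computed ones along the identity
  -- inclusion: `m ≤ k` and `k′ ≤ m′`.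
  (λ (_ , _ , k , k′ , κ , κ′ , k<k′) →
    ≤-trans (s≤s (γtR-mono G G (⊆ₑ-refl G) γ κ)) (≤-trans k<k′ (γtR-mono (G − E) (G − E) (⊆ₑ-refl (G − E)) κ′ γ′)))
  (m <? m′)

-- Makes a set of edges of `G` out of any Boolean matrix, by symmetrising and intersecting. The
-- search for edge sets can then range over all matrices.
restrict : Graph n → (Fin n → Fin n → Bool) → Graph n
adj        (restrict G M) u v = adj G u v ∧ (M u v ∨ M v u)
adj-sym    (restrict G M) u v = cong₂ _∧_ (adj-sym G u v) (∨-comm (M u v) (M v u))
adj-irrefl (restrict G M) v   = cong (_∧ (M v v ∨ M v v)) (adj-irrefl G v)

restrict-cong : (G : Graph n) {M N : Fin n → Fin n → Bool} →
  (∀ u v → M u v ≡ N u v) → restrict G M ⊆ₑ restrict G N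
restrict-cong G M≗N u v = subst T (cong (adj G u v ∧_) (cong₂ _∨_ (M≗N u v) (M≗N v u)))

restrict-⊆ : (G E : Graph n) → restrict G (adj E) ⊆ₑ E
restrict-⊆ G E u v e
  with Equivalence.to (T-∨ {adj E u v}) (proj₂ (Equivalence.to (T-∧ {adj G u v}) e))
... | inj₁ a = a
... | inj₂ a = adj-flip E a

⊆-restrict : (G E : Graph n) → E ⊆ₑ G → E ⊆ₑ restrict G (adj E)
⊆-restrict G E E⊆G u v e =
  Equivalence.from T-∧ (E⊆G u v e , Equivalence.from (T-∨ {adj E u v}) (inj₁ e))

raising-of-size-resp : (G : Graph n) (m : ℕ) (E F : Graph n) → E ⊆ₑ F → F ⊆ₑ E →
  Raises-γtR G E × size E ≡ m → Raises-γtR G F × size F ≡ m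
raising-of-size-resp G m E F E⊆F F⊆E (raises , eq) =
  Raises-resp G E F E⊆F F⊆E raises ,
  trans (≤-antisym (size-mono F E F⊆E) (size-mono E F E⊆F)) eq

raising-of-size? : (G : Graph n) → Decidable (λ m → ∃[ E ] (Raises-γtR G E × size E ≡ m))
raising-of-size? {n} G m = map′
  (λ (M , p) → restrict G M , p)
  (λ (E , p) → adj E ,
    raising-of-size-resp G m E (restrict G (adj E)) (⊆-restrict G E (proj₁ (proj₁ p))) (restrict-⊆ G E) p)
  (→-searchable {_≈_ = λ f g → ∀ v → f v ≡ g v} (λ _ → refl) (→-searchable refl Bool-searchable n) n
    (λ {M} {N} M≗N → raising-of-size-resp G m (restrict G M) (restrict G N)
      (restrict-cong G M≗N) (restrict-cong G (λ u v → sym (M≗N u v))))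
    (λ M → Raises? G (restrict G M) ×-dec (size (restrict G M) ≟ℕ m)))

-- A raising set by itself only bounds `btR`; that the least size exists constructively rests on the
-- decidability in `raising-of-size?`.
btR-≤-size : (G E : Graph n) → Raises-γtR G E → ∃[ b ] (btR≡ G b × b ≤⁺ [ size E ])
btR-≤-size G E raises with least (raising-of-size? G) (E , raises , refl)
... | b , b-least , b≤ = [ b ] , b-least , [ b≤ ]

-- Stars and their removal

-- Edges from the hub `w` to the vertices in `B`; the two disjuncts allow the hub at either end, and
-- `¬Bw` excludes a loop.
starAt : (w : Fin n) (B : Fin n → Bool) → ¬ T (B w) → Graph n
adj        (starAt w B ¬Bw) u v = does (w ≟ u) ∧ B v ∨ does (w ≟ v) ∧ B u
adj-sym    (starAt w B ¬Bw) u v = ∨-comm (does (w ≟ u) ∧ B v) (does (w ≟ v) ∧ B u)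
adj-irrefl (starAt w B ¬Bw) v with w ≟ v
... | no _ = refl
... | yes refl with B w
...   | false = refl
...   | true  = ⊥-elim (¬Bw tt)

<ᵇ-trichotomy : ∀ m n → m ≢ n → ⟦ m <ᵇ n ⟧ + ⟦ n <ᵇ m ⟧ ≡ 1
<ᵇ-trichotomy zero    zero    m≢n = contradiction refl m≢n
<ᵇ-trichotomy zero    (suc n) m≢n = refl
<ᵇ-trichotomy (suc m) zero    m≢n = refl
<ᵇ-trichotomy (suc m) (suc n) m≢n = <ᵇ-trichotomy m n (m≢n ∘ cong suc)

module _ (w : Fin n) (B : Fin n → Bool) (¬Bw : ¬ T (B w)) where

  starAt-hub : ∀ {v} → T (B v) → Adj (starAt w B ¬Bw) w v
  starAt-hub {v} Bv rewrite dec-true (w ≟ w) refl = Equivalence.from T-∨ (inj₁ Bv)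

  starAt-elim : ∀ {u v} → Adj (starAt w B ¬Bw) u v → (w ≡ u × T (B v)) ⊎ (w ≡ v × T (B u))
  starAt-elim {u} {v} e with w ≟ u | w ≟ v
  ... | yes p | no _  = inj₁ (p , subst T (∨-identityʳ (B v)) e)
  ... | no _  | yes q = inj₂ (q , e)
  ... | yes p | yes q with Equivalence.to (T-∨ {B v}) e
  ...   | inj₁ Bv = inj₁ (p , Bv)
  ...   | inj₂ Bu = inj₂ (q , Bu)

  starAt-⊆ : (G : Graph n) → (∀ {u} → T (B u) → Adj G w u) → starAt w B ¬Bw ⊆ₑ G
  starAt-⊆ G h u v e with starAt-elim e
  ... | inj₁ (refl , Bv) = h Bv
  ... | inj₂ (refl , Bu) = adj-flip G (h Bu)

  -- As `size` counts an edge in the row of its smaller end, spokes to vertices above `w` all fall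
  -- in row `w`, while a spoke to a vertex below `w` falls in the row of that vertex.
  size-starAt : size (starAt w B ¬Bw) ≡ ∣ tabulate B ∣
  size-starAt = begin
    size (starAt w B ¬Bw)
      ≡⟨ size≡∑ (starAt w B ¬Bw) ⟩
    ∑ (λ u → ∑ (λ v → ⟦ (toℕ u <ᵇ toℕ v) ∧ adj (starAt w B ¬Bw) u v ⟧))
      ≡⟨ ∑-cong (λ u → ∑-cong (edge u)) ⟩
    ∑ (λ u → ∑ (λ v → δ w u * above v + δ w v * below u))
      ≡⟨ ∑-cong row ⟩
    ∑ (λ u → δ w u * ∑ above + below u)
      ≡⟨ ∑-+ (λ u → δ w u * ∑ above) below ⟩
    ∑ (λ u → δ w u * ∑ above) + ∑ below
      ≡⟨ cong (_+ ∑ below) (∑-δ* w (λ _ → ∑ above)) ⟩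
    ∑ above + ∑ below
      ≡⟨ ∑-+ above below ⟨
    ∑ (λ u → above u + below u)
      ≡⟨ ∑-cong above+below ⟩
    ∑ (⟦_⟧ ∘ B)
      ≡⟨ ∣tabulate∣ B ⟨
    ∣ tabulate B ∣ ∎
    where
    open ≡-Reasoning
    above below : Fin n → ℕ
    above v = ⟦ (toℕ w <ᵇ toℕ v) ∧ B v ⟧
    below u = ⟦ (toℕ u <ᵇ toℕ w) ∧ B u ⟧

    edge : ∀ u v → ⟦ (toℕ u <ᵇ toℕ v) ∧ adj (starAt w B ¬Bw) u v ⟧ ≡ δ w u * above v + δ w v * below u
    edge u v with w ≟ u | w ≟ v
    ... | no _     | no _     = cong ⟦_⟧ (∧-zeroʳ (toℕ u <ᵇ toℕ v))
    ... | no _     | yes refl = sym (*-identityˡ _)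
    ... | yes refl | no _     rewrite ∨-identityʳ (B v) =
      sym (trans (+-identityʳ (1 * above v)) (*-identityˡ (above v)))
    ... | yes refl | yes refl with B w
    ...   | true  = ⊥-elim (¬Bw tt)
    ...   | false rewrite ∧-zeroʳ (toℕ w <ᵇ toℕ w) = refl

    row : ∀ u → ∑ (λ v → δ w u * above v + δ w v * below u) ≡ δ w u * ∑ above + below u
    row u = trans (∑-+ (λ v → δ w u * above v) (λ v → δ w v * below u))
      (cong₂ _+_ (sym (*-distribˡ-sum +-*-semiring (δ w u) above)) (∑-δ* w (λ _ → below u)))

    above+below : ∀ u → above u + below u ≡ ⟦ B u ⟧
    above+below u with toℕ w <ᵇ toℕ u | toℕ u <ᵇ toℕ w | <ᵇ-trichotomy (toℕ w) (toℕ u)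
    ... | true  | false | _ = +-identityʳ _
    ... | false | true  | _ = refl
    -- Two equal comparison results contradict trichotomy unless `w` and `u` coincide, and there `B`
    -- is false.
    ... | true  | true  | h with B u in eq
    ...   | false = refl
    ...   | true  = contradiction (h λ w≡u → ¬Bw (subst (T ∘ B) (sym (toℕ-injective w≡u)) (subst T (sym eq) tt))) λ ()
    above+below u | false | false | h with B u in eq
    ...   | false = refl
    ...   | true  = h λ w≡u → ¬Bw (subst (T ∘ B) (sym (toℕ-injective w≡u)) (subst T (sym eq) tt))

-- Pendant vertices and their supports

module _ (H : Graph n) {y z : Fin n} (pendant : ∀ u → Adj H y u → u ≡ z)
         {f : Labelling H} (trdf : IsTRDF H f) where

  -- The only possible neighbour of `y` is `z`, which must have label 2 to dominate `y` if `f y` is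
  -- 0, and a positive label to accompany `y` otherwise.
  support>0 : 0 < toℕ (f z)
  support>0 with toℕ (f y) in eq
  ... | zero with proj₁ trdf y eq
  ...   | u , e , fu≡2 rewrite pendant u e = subst (0 <_) (sym fu≡2) (s≤s z≤n)
  support>0 | suc _ with proj₂ trdf y (subst (0 <_) (sym eq) (s≤s z≤n))
  ...   | u , e , fu>0 rewrite pendant u e = fu>0

  pendant+support≥2 : 2 ≤ toℕ (f y) + toℕ (f z)
  pendant+support≥2 with toℕ (f y) in eq
  ... | suc _ = s≤s (≤-trans support>0 (m≤n+m _ _))
  ... | zero with proj₁ trdf y eq
  ...   | u , e , fu≡2 rewrite pendant u e = ≤-reflexive (sym fu≡2)

  support≢2⇒pendant>0 : toℕ (f z) ≢ 2 → 0 < toℕ (f y)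
  support≢2⇒pendant>0 fz≢2 = n≢0⇒n>0 λ fy≡0 →
    let u , e , fu≡2 = proj₁ trdf y fy≡0 in fz≢2 (subst (λ v → toℕ (f v) ≡ 2) (pendant u e) fu≡2)

-- A star component of H centred at w costs at least 3; in G its leaves can
-- be relabelled 0, as the 2 at w has z as its positive neighbour.
module _ (H G : Graph n) (H⊆G : H ⊆ₑ G) (w : Fin n)
  (pendants : ∀ p → Adj H w p → ∀ u → Adj H p u → u ≡ w)
  {a b : Fin n} (a≢b : a ≢ b) (wa : Adj H w a) (wb : Adj H w b)
  {y z : Fin n} (wz : Adj G w z) (¬wz : ¬ Adj H w z) (pendant-y : ∀ u → Adj H y u → u ≡ z)
  {f : Labelling H} (trdf : IsTRDF H f) where

  private
    g : Labelling G
    g u = if does (w ≟ u) then suc (suc zero) else if adj H w u then zero else f u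

    data View (u : Fin n) : Set where
      hub  : w ≡ u → toℕ (g u) ≡ 2 → View u
      leaf : w ≢ u → Adj H w u → toℕ (g u) ≡ 0 → View u
      far  : w ≢ u → ¬ Adj H w u → g u ≡ f u → View u

    view : ∀ u → View u
    view u with w ≟ u in eq₁ | adj H w u in eq₂
    ... | yes w≡u | _     = hub w≡u (cong toℕ (g-hub w≡u))
      where
      g-hub : w ≡ u → g u ≡ suc (suc zero)
      g-hub w≡u rewrite dec-true (w ≟ u) w≡u = refl
    ... | no w≢u  | true  = leaf w≢u (subst T (sym eq₂) tt) (cong toℕ g-leaf)
      where
      g-leaf : g u ≡ zero
      g-leaf rewrite dec-false (w ≟ u) w≢u | eq₂ = refl
    ... | no w≢u  | false = far w≢u (subst T eq₂) g-far
      where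
      g-far : g u ≡ f u
      g-far rewrite dec-false (w ≟ u) w≢u | eq₂ = refl

    g-hub : toℕ (g w) ≡ 2
    g-hub with view w
    ... | hub _ eq     = eq
    ... | leaf w≢w _ _ = contradiction refl w≢w
    ... | far w≢w _ _  = contradiction refl w≢w

    g-trdf : IsTRDF G g
    g-trdf = dom , tot
      where
      dom : ∀ v → toℕ (g v) ≡ 0 → ∃[ u ] (Adj G v u × toℕ (g u) ≡ 2)
      dom v gv≡0 with view v
      ... | hub _ gv≡2 = contradiction (trans (sym gv≡2) gv≡0) λ ()
      ... | leaf _ wv _ = w , adj-flip G (H⊆G w v wv) , g-hub
      ... | far w≢v ¬wv gv≡fv with proj₁ trdf v (trans (cong toℕ (sym gv≡fv)) gv≡0)
      ...   | u , vu , fu≡2 with view u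
      ...     | hub _ gu≡2     = u , H⊆G v u vu , gu≡2
      -- A leaf of the star is adjacent in `H` to the hub alone, so `v` would be `w`.
      ...     | leaf _ wu _    = contradiction (sym (pendants u wu v (adj-flip H vu))) w≢v
      ...     | far _ _ gu≡fu  = u , H⊆G v u vu , trans (cong toℕ gu≡fu) fu≡2

      tot : ∀ v → 0 < toℕ (g v) → ∃[ u ] (Adj G v u × 0 < toℕ (g u))
      tot v gv>0 with view v
      ... | leaf _ _ gv≡0 = contradiction (sym gv≡0) (<⇒≢ gv>0)
      -- The leaves now have label 0, so the hub relies on `z`, which lies outside the star and
      -- keeps the positive label it has as support of `y`.
      ... | hub refl _ with view z
      ...   | hub w≡z _     = contradiction w≡z (adj⇒≢ G wz)
      ...   | leaf _ wz′ _  = contradiction wz′ ¬wz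
      ...   | far _ _ gz≡fz = z , wz , subst (λ l → 0 < toℕ l) (sym gz≡fz) (support>0 H pendant-y trdf)
      tot v gv>0 | far w≢v ¬wv gv≡fv with proj₂ trdf v (subst (λ l → 0 < toℕ l) gv≡fv gv>0)
      ...   | u , vu , fu>0 with view u
      ...     | hub _ gu≡2    = u , H⊆G v u vu , subst (0 <_) (sym gu≡2) (s≤s z≤n)
      ...     | leaf _ wu _   = contradiction (sym (pendants u wu v (adj-flip H vu))) w≢v
      ...     | far _ _ gu≡fu = u , H⊆G v u vu , subst (λ l → 0 < toℕ l) (sym gu≡fu) fu>0

    -- If f w = 2, the label of a positive leaf p of the star is saved.
    g-lighter-2 : toℕ (f w) ≡ 2 → weight G g < weight H f
    g-lighter-2 fw≡2 with proj₂ trdf w (subst (0 <_) (sym fw≡2) (s≤s z≤n))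
    ... | p , wp , fp>0 = begin-strict
      weight G g                        <⟨ ≤-reflexive (sym (+-comm _ 1)) ⟩
      weight G g + 1                    ≡⟨ cong (weight G g +_) (∑-δ p) ⟨
      weight G g + ∑ (δ p)              ≡⟨ ∑-+ (toℕ ∘ g) (δ p) ⟨
      ∑ (λ u → toℕ (g u) + δ p u)       ≤⟨ ∑-mono pointwise ⟩
      weight H f                        ∎
      where
      open ≤-Reasoning
      pointwise : ∀ u → toℕ (g u) + δ p u ≤ toℕ (f u)
      pointwise u with p ≟ u | view u
      ... | yes refl | hub w≡u _       = contradiction w≡u (adj⇒≢ H wp)
      ... | yes refl | leaf _ _ gu≡0   rewrite gu≡0 = fp>0
      ... | yes refl | far _ ¬wu _     = contradiction wp ¬wu
      ... | no _     | hub refl gu≡2   rewrite gu≡2 | fw≡2 = ≤-refl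
      ... | no _     | leaf _ _ gu≡0   rewrite gu≡0 = z≤n
      ... | no _     | far _ _ gu≡fu   rewrite gu≡fu = ≤-reflexive (+-identityʳ _)

    -- If f w = 1, both a and b are positive, and only one of the two units
    -- saved there is spent on raising w.
    g-lighter-1 : toℕ (f w) ≢ 2 → weight G g < weight H f
    -- The unit spent at `w` goes to the right-hand side as `δ w`, which makes the comparison
    -- pointwise and free of subtraction.
    g-lighter-1 fw≢2 = +-cancelʳ-≤ 1 _ _ (begin
      suc (weight G g) + 1                  ≡⟨ +-suc (weight G g) 1 ⟨
      weight G g + 2                        ≡⟨ cong (weight G g +_) (cong₂ _+_ (∑-δ a) (∑-δ b)) ⟨
      weight G g + (∑ (δ a) + ∑ (δ b))      ≡⟨ cong (weight G g +_) (∑-+ (δ a) (δ b)) ⟨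
      weight G g + ∑ (λ u → δ a u + δ b u)  ≡⟨ ∑-+ (toℕ ∘ g) (λ u → δ a u + δ b u) ⟨
      ∑ (λ u → toℕ (g u) + (δ a u + δ b u)) ≤⟨ ∑-mono pointwise ⟩
      ∑ (λ u → toℕ (f u) + δ w u)           ≡⟨ ∑-+ (toℕ ∘ f) (δ w) ⟩
      weight H f + ∑ (δ w)                  ≡⟨ cong (weight H f +_) (∑-δ w) ⟩
      weight H f + 1                        ∎)
      where
      open ≤-Reasoning
      δ≡0 : ∀ {c u : Fin n} → c ≢ u → δ c u ≡ 0
      δ≡0 {c} {u} c≢u = cong ⟦_⟧ (dec-false (c ≟ u) c≢u)

      δ≡1 : ∀ (u : Fin n) → δ u u ≡ 1
      δ≡1 u = cong ⟦_⟧ (dec-true (u ≟ u) refl)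

      δ+δ≤1 : ∀ u → δ a u + δ b u ≤ 1
      δ+δ≤1 u with a ≟ u | b ≟ u
      ... | yes refl | yes refl = contradiction refl a≢b
      ... | yes _    | no _     = ≤-refl
      ... | no _     | yes _    = ≤-refl
      ... | no _     | no _     = z≤n

      pointwise : ∀ u → toℕ (g u) + (δ a u + δ b u) ≤ toℕ (f u) + δ w u
      pointwise u with view u
      ... | hub refl gu≡2 rewrite gu≡2 | δ≡0 (adj⇒≢ H wa ∘ sym) | δ≡0 (adj⇒≢ H wb ∘ sym) | δ≡1 w =
        +-mono-≤ (support>0 H (pendants a wa) trdf) ≤-refl
      ... | leaf w≢u wu gu≡0 rewrite gu≡0 =
        ≤-trans (δ+δ≤1 u) (≤-trans (support≢2⇒pendant>0 H (pendants u wu) trdf fw≢2) (m≤m+n _ _))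
      ... | far w≢u ¬wu gu≡fu
        rewrite gu≡fu | δ≡0 {a} {u} (λ { refl → ¬wu wa }) | δ≡0 {b} {u} (λ { refl → ¬wu wb }) =
        +-mono-≤ ≤-refl z≤n

  -- The star weighs at least 3 under `f` and exactly 2 under `g`; where the 3 comes from depends on
  -- whether `f w` is 2.
  attach-star : ∃[ g ] (IsTRDF G g × weight G g < weight H f)
  attach-star with toℕ (f w) ≟ℕ 2
  ... | yes fw≡2 = g , g-trdf , g-lighter-2 fw≡2
  ... | no fw≢2  = g , g-trdf , g-lighter-1 fw≢2

-- `B` marks the neighbours of `w` to be cut off, each of which has another neighbour by `escape`.
-- The remaining neighbours are pendant, at least two in number, and form the star component. The
-- cut neighbour `z` supports the pendant `y`.
module _ (G : Graph n) (iso : NoIsolated G) (w : Fin n) (B : Fin n → Bool) (¬Bw : ¬ T (B w))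
  (B⊆N : ∀ {u} → T (B u) → Adj G w u)
  (escape : ∀ {u} → T (B u) → ∃[ y ] (w ≢ y × Adj G u y))
  (pendants : ∀ p → Adj G w p → ¬ T (B p) → ∀ u → Adj G p u → u ≡ w)
  {a b : Fin n} (a≢b : a ≢ b) (wa : Adj G w a) (¬Ba : ¬ T (B a)) (wb : Adj G w b) (¬Bb : ¬ T (B b))
  {y z : Fin n} (Bz : T (B z)) (pendant-y : ∀ u → Adj G y u → u ≡ z) where

  private
    E H : Graph n
    E = starAt w B ¬Bw
    H = G − E

    keep-hub : ∀ {u} → Adj G w u → ¬ T (B u) → Adj H w u
    keep-hub {u} wu ¬Bu = −-intro G E wu λ e → [ ¬Bu ∘ proj₂ , ¬Bw ∘ proj₂ ]′ (starAt-elim w B ¬Bw e)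

    cut-hub : ∀ {u} → Adj H w u → ¬ T (B u)
    cut-hub wu Bu = −-avoids G E wu (starAt-hub w B ¬Bw Bu)

    -- The hub keeps `a`, a cut neighbour keeps the edge from `escape`, and every other vertex loses
    -- nothing.
    H-iso : NoIsolated H
    H-iso u = go (w ≟ u) (T? (B u))
      where
      go : Dec (w ≡ u) → Dec (T (B u)) → ∃[ p ] Adj H u p
      go (yes refl) _ = a , keep-hub wa ¬Ba
      go (no w≢u) (yes Bu) = let p , w≢p , up = escape Bu in
        p , −-intro G E up λ e → [ w≢u ∘ proj₁ , w≢p ∘ proj₁ ]′ (starAt-elim w B ¬Bw e)
      go (no w≢u) (no ¬Bu) = let p , up = iso u in
        p , −-intro G E up λ e → [ w≢u ∘ proj₁ , ¬Bu ∘ proj₂ ]′ (starAt-elim w B ¬Bw e)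

  -- `attach-star` turns a minimum TRDF of `H` into a strictly lighter TRDF of `G`.
  starAt-raises : Raises-γtR G E
  starAt-raises with γtR-exists G iso | γtR-exists H H-iso
  ... | m , γ | m′ , γ′@((f , trdf , refl) , _)
    with attach-star H G (−-⊆ G E) w
      (λ p wp u pu → pendants p (−-⊆ G E w p wp) (cut-hub wp) u (−-⊆ G E p u pu))
      a≢b (keep-hub wa ¬Ba) (keep-hub wb ¬Bb) (B⊆N Bz) (λ wz → cut-hub wz Bz)
      (λ u yu → pendant-y u (−-⊆ G E y u yu)) trdf
  ...   | g , g-trdf , g<f =
    starAt-⊆ w B ¬Bw G B⊆N , H-iso , m , m′ , γ , γ′ , ≤-trans (s≤s (proj₂ γ _ (g , g-trdf , refl))) g<f

-- Deleting no edge leaves `γtR` unchanged, so `E` has an edge; that edge is viewed as a star with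
-- one spoke, whose size is known.
Raises⇒size≥1 : (G E : Graph n) → Raises-γtR G E → 1 ≤ size E
Raises⇒size≥1 G E (E⊆G , _ , m , m′ , γ , γ′ , m<m′) with any? (λ u → any? (λ v → T? (adj E u v)))
... | no ¬e = contradiction m<m′ (≤⇒≯ (γtR-mono G (G − E) G⊆G−E γ′ γ))
  where
  G⊆G−E : G ⊆ₑ (G − E)
  G⊆G−E u v uv = −-intro G E uv λ e → ¬e (u , v , e)
... | yes (u , v , uv) = begin
  1                                ≤⟨ member⇒1≤∣∣ (λ c → does (v ≟ c)) {v} (≡⇒≟ {a = v} refl) ⟩
  ∣ tabulate (λ c → does (v ≟ c)) ∣ ≡⟨ size-starAt u _ ¬Bu ⟨
  size (starAt u _ ¬Bu)            ≤⟨ size-mono (starAt u _ ¬Bu) E (starAt-⊆ u _ ¬Bu E λ {c} v≟c → subst (Adj E u) (≟⇒≡ v≟c) uv) ⟩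
  size E                           ∎
  where
  open ≤-Reasoning
  ¬Bu : ¬ T (does (v ≟ u))
  ¬Bu v≟u = adj⇒≢ E uv (sym (≟⇒≡ v≟u))

-- Leaves and rooted trees

T-not-from : ∀ {b} → ¬ T b → T (not b)
T-not-from {true}  h = h tt
T-not-from {false} h = tt

T-not-to : ∀ {b} → T (not b) → ¬ T b
T-not-to {false} _ ()

module _ (G : Graph n) where

  two-neighbours⇒¬Leaf : ∀ {u a b} → a ≢ b → Adj G u a → Adj G u b → ¬ Leaf G u
  two-neighbours⇒¬Leaf {u} a≢b ua ub leaf =
    <⇒≢ (two-members⇒2≤∣∣ (adj G u) a≢b ua ub) (sym leaf)

  leaf⇒pendant : ∀ {y w} → Leaf G y → Adj G y w → ∀ u → Adj G y u → u ≡ w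
  leaf⇒pendant {y} {w} leaf yw u yu =
    decidable-stable (u ≟ w) λ u≢w → two-neighbours⇒¬Leaf u≢w yu yw leaf

  ¬Leaf⇒other-neighbour : ∀ {u w} → Adj G u w → ¬ Leaf G u → ∃[ y ] (w ≢ y × Adj G u y)
  ¬Leaf⇒other-neighbour {u} {w} uw ¬leaf with any? (λ y → ¬? (w ≟ y) ×-dec T? (adj G u y))
  ... | yes p = p
  ... | no ¬p = contradiction
    (≤-antisym
      (unique⇒∣∣≤1 (adj G u) w λ y uy → decidable-stable (w ≟ y) λ w≢y → ¬p (y , w≢y , uy))
      (member⇒1≤∣∣ (adj G u) uw))
    ¬leaf

  leafAt⁻ : ∀ {v u} → T (adj G v u ∧ (deg G u ≡ᵇ 1)) → Adj G v u × Leaf G u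
  leafAt⁻ {v} {u} t = let vu , d = Equivalence.to (T-∧ {adj G v u}) t in vu , ≡ᵇ⇒≡ (deg G u) 1 d

  leaf-neighbour : ∀ {v} → 1 ≤ leavesAt G v → ∃[ u ] (Adj G v u × Leaf G u)
  leaf-neighbour 1≤ = let u , t = member _ 1≤ in u , leafAt⁻ t

  two-leaf-neighbours : ∀ {v} → 2 ≤ leavesAt G v →
    ∃[ a ] ∃[ b ] (a ≢ b × (Adj G v a × Leaf G a) × (Adj G v b × Leaf G b))
  two-leaf-neighbours 2≤ =
    let a , b , a≢b , ta , tb = two-members _ 2≤ in a , b , a≢b , leafAt⁻ ta , leafAt⁻ tb

  -- The given edge serves its own end `x`; from any other vertex, the first step of a walk to `x`
  -- is an edge.
  connected⇒NoIsolated : Connected G → ∀ {u v} → Adj G u v → NoIsolated G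
  connected⇒NoIsolated conn {x} {v} xv u with u ≟ x
  ... | yes refl = v , xv
  ... | no u≢x with conn u x
  ...   | ε     = contradiction refl u≢x
  ...   | e ◅ _ = _ , e

  1≤∣vertices∣ : ∀ {u v} (p : Walk G u v) → 1 ≤ length (vertices G p)
  1≤∣vertices∣ ε       = s≤s z≤n
  1≤∣vertices∣ (_ ◅ _) = s≤s z≤n

  -- Transfer of `All P` is needed twice: to keep the prefix a path in the induction, and to know
  -- that it avoids `x` when a cycle is closed.
  walk-prefix : ∀ {u v c} (p : Walk G u v) → c ∈ vertices G p →
    Σ[ q ∈ Walk G u c ] ((∀ {P : Fin n → Set} → All P (vertices G p) → All P (vertices G q)) ×
                         (IsPath G p → IsPath G q))
  walk-prefix ε       (here refl) = ε , id , id
  walk-prefix (e ◅ p) (here refl) = ε , (λ { (Pu ∷ _) → Pu ∷ [] }) , λ _ → [] ∷ []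
  walk-prefix (e ◅ p) (there c∈p) with walk-prefix p c∈p
  ... | q , sub , path = e ◅ q , (λ { (Pu ∷ Pp) → Pu ∷ sub Pp }) , λ { (u∉p ∷ p-path) → sub u∉p ∷ path p-path }

  -- A neighbour of x on the path from x to the root, other than the parent,
  -- would close a cycle.
  neighbour⇒child : ¬ HasCycle G → ∀ {r v x c} → Parent G r v x → Adj G x c → c ≢ v → Parent G r x c
  neighbour⇒child acyclic {r} {v} {x} {c} (xv , p , x∉p ∷ p-path) xc c≢v =
    adj-flip G xc , xv ◅ p , (adj⇒≢ G (adj-flip G xc) ∷ All.tabulate c∉p) ∷ (x∉p ∷ p-path)
    where
    c∉p : ∀ {d} → d ∈ vertices G p → c ≢ d
    c∉p c∈p refl with walk-prefix p c∈p
    ... | ε     , _   , _    = c≢v refl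
    -- The cycle goes from `x` to `v` and along the prefix to `c`; as the prefix is nonempty, it has
    -- at least three vertices.
    ... | e ◅ q , sub , path = acyclic (x , c , xv ◅ e ◅ q , sub x∉p ∷ path p-path , s≤s (s≤s (1≤∣vertices∣ q)) , adj-flip G xc)

  -- The hub is `x` and the single cut edge is `x v`. The leaf `l` both saves `v` from isolation and
  -- forces its label to be positive.
  btR≡1 : IsTree G → ∀ {r x v} → HeightOne G r x → Parent G r v x →
    1 ≤ leavesAt G v → 2 ≤ leavesAt G x → btR≡ G [ 1 ]
  btR≡1 (conn , acyclic) {r} {x} {v} (_ , _ , children) parent@(xv , _) 1≤ 2≤
    with leaf-neighbour 1≤ | two-leaf-neighbours 2≤
  ... | l , vl , l-leaf | a , b , a≢b , (xa , a-leaf) , (xb , b-leaf) =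
    (starAt x B ¬Bx , raises , trans (size-starAt x B ¬Bx) ∣B∣≡1) ,
    λ { k (E , E-raises , refl) → Raises⇒size≥1 G E E-raises }
    where
    B : Fin n → Bool
    B u = does (v ≟ u)

    ¬Bx : ¬ T (B x)
    ¬Bx v≟x = adj⇒≢ G xv (sym (≟⇒≡ v≟x))

    x≢l : x ≢ l
    x≢l refl = two-neighbours⇒¬Leaf a≢b xa xb l-leaf

    v-¬leaf : ¬ Leaf G v
    v-¬leaf = two-neighbours⇒¬Leaf x≢l (adj-flip G xv) vl

    leaf⇒¬B : ∀ {u} → Leaf G u → ¬ T (B u)
    leaf⇒¬B u-leaf v≟u = v-¬leaf (subst (Leaf G) (sym (≟⇒≡ v≟u)) u-leaf)

    Bv : T (B v)
    Bv = ≡⇒≟ {a = v} refl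

    ∣B∣≡1 : ∣ tabulate B ∣ ≡ 1
    ∣B∣≡1 = trans (∣tabulate∣ B) (∑-δ v)

    raises : Raises-γtR G (starAt x B ¬Bx)
    raises = starAt-raises G (connected⇒NoIsolated conn xv) x B ¬Bx
      (λ {u} v≟u → subst (Adj G x) (≟⇒≡ v≟u) xv)
      (λ {u} v≟u → l , x≢l , subst (λ c → Adj G c l) (≟⇒≡ v≟u) vl)
      -- By acyclicity a neighbour of `x` other than the parent is a child, hence a leaf because `x`
      -- has height one.
      (λ p xp ¬Bp → leaf⇒pendant
        (children p (neighbour⇒child acyclic parent xp λ p≡v → ¬Bp (≡⇒≟ (sym p≡v))))
        (adj-flip G xp))
      a≢b xa (leaf⇒¬B a-leaf) xb (leaf⇒¬B b-leaf)
      Bv (leaf⇒pendant l-leaf (adj-flip G vl))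

  -- The hub is `v`, cut off from its non-leaf neighbours. Among these is `x`, the support of its
  -- leaf `c`.
  btR≤deg∸leavesAt : Connected G → ∀ {x v} → Adj G x v → 2 ≤ leavesAt G v → leavesAt G x ≡ 1 →
    ∃[ b ] (btR≡ G b × b ≤⁺ [ deg G v ∸ leavesAt G v ])
  btR≤deg∸leavesAt conn {x} {v} xv 2≤ ≡1
    with leaf-neighbour (≤-reflexive (sym ≡1)) | two-leaf-neighbours 2≤
  ... | c , xc , c-leaf | a , b , a≢b , (va , a-leaf) , (vb , b-leaf) =
    subst (λ d → ∃[ b ] (btR≡ G b × b ≤⁺ [ d ])) (trans (size-starAt v B ¬Bv) ∣B∣≡)
      (btR-≤-size G (starAt v B ¬Bv) raises)
    where
    B : Fin n → Bool
    B u = adj G v u ∧ not (deg G u ≡ᵇ 1)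

    B⁺ : ∀ {u} → Adj G v u → ¬ Leaf G u → T (B u)
    B⁺ {u} vu ¬leaf = Equivalence.from T-∧ (vu , T-not-from (¬leaf ∘ ≡ᵇ⇒≡ (deg G u) 1))

    B⁻ : ∀ {u} → T (B u) → Adj G v u × ¬ Leaf G u
    B⁻ {u} Bu = let vu , d = Equivalence.to (T-∧ {adj G v u}) Bu in
      vu , T-not-to d ∘ ≡⇒≡ᵇ (deg G u) 1

    ¬Bv : ¬ T (B v)
    ¬Bv Bv = adj⇒≢ G (proj₁ (B⁻ Bv)) refl

    c≢v : c ≢ v
    c≢v refl = two-neighbours⇒¬Leaf a≢b va vb c-leaf

    ∣B∣≡ : ∣ tabulate B ∣ ≡ deg G v ∸ leavesAt G v
    -- Leaf and non-leaf neighbours partition the neighbourhood of `v`; the leaf count is added back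
    -- before being subtracted.
    ∣B∣≡ = trans (sym (m+n∸n≡m ∣ tabulate B ∣ (leavesAt G v))) (cong (_∸ leavesAt G v) (begin
      ∣ tabulate B ∣ + leavesAt G v  ≡⟨ cong₂ _+_ (∣tabulate∣ B) (∣tabulate∣ leaf?) ⟩
      ∑ (⟦_⟧ ∘ B) + ∑ (⟦_⟧ ∘ leaf?)  ≡⟨ ∑-+ (⟦_⟧ ∘ B) (⟦_⟧ ∘ leaf?) ⟨
      _                              ≡⟨ ∑-cong (λ u → split (adj G v u) (deg G u ≡ᵇ 1)) ⟩
      ∑ (⟦_⟧ ∘ adj G v)              ≡⟨ ∣tabulate∣ (adj G v) ⟨
      deg G v                        ∎))
      where
      open ≡-Reasoning
      leaf? : Fin n → Bool
      leaf? u = adj G v u ∧ (deg G u ≡ᵇ 1)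
      split : ∀ p q → ⟦ p ∧ not q ⟧ + ⟦ p ∧ q ⟧ ≡ ⟦ p ⟧
      split false _     = refl
      split true  false = refl
      split true  true  = refl

    raises : Raises-γtR G (starAt v B ¬Bv)
    raises = starAt-raises G (connected⇒NoIsolated conn xv) v B ¬Bv
      (proj₁ ∘ B⁻)
      (λ Bu → let vu , ¬leaf = B⁻ Bu in ¬Leaf⇒other-neighbour (adj-flip G vu) ¬leaf)
      (λ p vp ¬Bp → leaf⇒pendant (decidable-stable (deg G p ≟ℕ 1) (¬Bp ∘ B⁺ vp)) (adj-flip G vp))
      a≢b va (λ Ba → proj₂ (B⁻ Ba) a-leaf) vb (λ Bb → proj₂ (B⁻ Bb) b-leaf)
      (B⁺ (adj-flip G xv) (two-neighbours⇒¬Leaf c≢v xc xv))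
      (leaf⇒pendant c-leaf (adj-flip G xc))

-- Wounded spiders

-- `S k t` with the number `s` of subdivided edges as a parameter of its own, which keeps truncated
-- subtraction out of the vertex type.
spider : ∀ t s → Graph (suc (t + s))
adj        (spider t s) u v = spiderAdj (spiderVertex t s u) (spiderVertex t s v)
adj-sym    (spider t s) u v = spiderAdj-sym (spiderVertex t s u) (spiderVertex t s v)
adj-irrefl (spider t s) v   = spiderAdj-irrefl (spiderVertex t s v)

module Spider (t s : ℕ) where

  index : SpiderVertex t s → Fin (suc (t + s))
  index centre  = zero
  index (end i) = suc (i ↑ˡ s)
  index (mid j) = suc (t ↑ʳ j)

  spiderVertex-index : ∀ x → spiderVertex t s (index x) ≡ x
  spiderVertex-index centre  = refl
  spiderVertex-index (end i) = cong [ end , mid ]′ (splitAt-↑ˡ t i s)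
  spiderVertex-index (mid j) = cong [ end , mid ]′ (splitAt-↑ʳ t s j)

  index-spiderVertex : ∀ u → index (spiderVertex t s u) ≡ u
  index-spiderVertex zero = refl
  index-spiderVertex (suc i) with splitAt t i | join-splitAt t s i
  ... | inj₁ _ | eq = cong suc eq
  ... | inj₂ _ | eq = cong suc eq

  index-injective : ∀ {x y} → index x ≡ index y → x ≡ y
  index-injective {x} {y} eq =
    trans (sym (spiderVertex-index x)) (trans (cong (spiderVertex t s) eq) (spiderVertex-index y))

  -- Replaces numbered vertices by the constructors of `SpiderVertex`, on which `spiderAdj`
  -- computes.
  ∀-index : {P : Fin (suc (t + s)) → Set} → (∀ x → P (index x)) → ∀ u → P u
  ∀-index {P} h u = subst P (index-spiderVertex u) (h (spiderVertex t s u))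

  adj-index : ∀ x y → adj (spider t s) (index x) (index y) ≡ spiderAdj x y
  adj-index x y = cong₂ spiderAdj (spiderVertex-index x) (spiderVertex-index y)

  Adj-index⁺ : ∀ x y → T (spiderAdj x y) → Adj (spider t s) (index x) (index y)
  Adj-index⁺ x y = subst T (sym (adj-index x y))

  Adj-index⁻ : ∀ x y → Adj (spider t s) (index x) (index y) → T (spiderAdj x y)
  Adj-index⁻ x y = subst T (adj-index x y)

  ∑-spider : (f : Fin (suc (t + s)) → ℕ) →
    ∑ f ≡ f (index centre) + (∑ (f ∘ index ∘ end) + ∑ (f ∘ index ∘ mid))
  ∑-spider f = cong (f zero +_) (∑-splitAt t (f ∘ suc))

  inner-end-pendant : ∀ (i : Fin t) (y : SpiderVertex t s) → toℕ i < s → T (spiderAdj (end i) y) → ∃[ j ] (y ≡ mid j × toℕ i ≡ toℕ j)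
  inner-end-pendant i centre  i<s e = contradiction (<⇒<ᵇ i<s) (T-not-to e)
  inner-end-pendant i (mid j) i<s e = j , refl , ≡ᵇ⇒≡ (toℕ i) (toℕ j) e

  outer-end-pendant : ∀ (i : Fin t) (y : SpiderVertex t s) → s ≤ toℕ i → T (spiderAdj (end i) y) → y ≡ centre
  outer-end-pendant i centre  s≤i e = refl
  outer-end-pendant i (mid j) s≤i e =
    contradiction (subst (_< s) (sym (≡ᵇ⇒≡ (toℕ i) (toℕ j) e)) (toℕ<n j)) (≤⇒≯ s≤i)

  centre-end : ∀ {i} → s ≤ toℕ i → T (spiderAdj {t} {s} centre (end i))
  centre-end {i} s≤i = T-not-from (≤⇒≯ s≤i ∘ <ᵇ⇒< (toℕ i) s)

  centre-end⁻ : ∀ {i} → T (spiderAdj {t} {s} centre (end i)) → s ≤ toℕ i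
  centre-end⁻ {i} e = ≮⇒≥ (T-not-to e ∘ <⇒<ᵇ)

  isMid : SpiderVertex t s → Bool
  isMid (mid _) = true
  isMid _       = false

  midAt : Fin (suc (t + s)) → Bool
  midAt u = isMid (spiderVertex t s u)

  midAt-index : ∀ x → midAt (index x) ≡ isMid x
  midAt-index x = cong isMid (spiderVertex-index x)

  midAt⁻ : ∀ u → T (midAt u) → ∃[ j ] index (mid j) ≡ u
  midAt⁻ u m with spiderVertex t s u | index-spiderVertex u
  ... | mid j | eq = j , eq

  ∣midAt∣ : ∣ tabulate midAt ∣ ≡ s
  ∣midAt∣ = begin
    ∣ tabulate midAt ∣  ≡⟨ ∣tabulate∣ midAt ⟩
    ∑ (⟦_⟧ ∘ midAt)     ≡⟨ ∑-spider (⟦_⟧ ∘ midAt) ⟩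
    _                   ≡⟨ cong₂ _+_ (∑-cong (λ i → cong ⟦_⟧ (midAt-index (end i))))
                                     (∑-cong (λ j → cong ⟦_⟧ (midAt-index (mid j)))) ⟩
    ∑ {t} (λ _ → 0) + ∑ {s} (λ _ → 1)
                        ≡⟨ cong₂ _+_ (∑-zero t) (∑-one s) ⟩
    s                   ∎
    where open ≡-Reasoning

  spokes : Graph (suc (t + s))
  spokes = starAt (index centre) midAt (λ ())

  size-spokes : size spokes ≡ s
  size-spokes = trans (size-starAt (index centre) midAt (λ ())) ∣midAt∣

-- Of the t = s + k feet, the first s are on subdivided edges.
module _ (s k : ℕ) where

  open Spider (s + k) s

  private
    G : Graph (suc (s + k + s))
    G = spider (s + k) s

    inner : Fin s → SpiderVertex (s + k) s
    inner j = end (j ↑ˡ k)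

    outer : Fin k → SpiderVertex (s + k) s
    outer i = end (s ↑ʳ i)

    s≤outer : ∀ (i : Fin k) → s ≤ toℕ (s ↑ʳ i)
    s≤outer i = subst (s ≤_) (sym (toℕ-↑ʳ s i)) (m≤m+n s (toℕ i))

    inner<s : ∀ (j : Fin s) → toℕ (j ↑ˡ k) < s
    inner<s j = subst (_< s) (sym (toℕ-↑ˡ j k)) (toℕ<n j)

    mid-inner : ∀ j → T (spiderAdj (mid j) (inner j))
    mid-inner j = ≡⇒≡ᵇ _ _ (toℕ-↑ˡ j k)

    outer-pendant : ∀ i → s ≤ toℕ i → ∀ u → Adj G (index (end i)) u → u ≡ index centre
    outer-pendant i s≤i = ∀-index λ y e → cong index (outer-end-pendant i y s≤i (Adj-index⁻ (end i) y e))

    inner-pendant : ∀ j u → Adj G (index (inner j)) u → u ≡ index (mid j)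
    inner-pendant j = ∀-index λ y e → cong index (lemma y (Adj-index⁻ (inner j) y e))
      where
      lemma : ∀ y → T (spiderAdj (inner j) y) → y ≡ mid j
      lemma y e with inner-end-pendant (j ↑ˡ k) y (inner<s j) e
      ... | j′ , refl , eq = cong mid (toℕ-injective (trans (sym eq) (toℕ-↑ˡ j k)))

    ∑-spider-legs : (f : Fin (suc (s + k + s)) → ℕ) →
      ∑ f ≡ f (index centre) + (∑ (f ∘ index ∘ inner) + ∑ (f ∘ index ∘ outer) + ∑ (f ∘ index ∘ mid))
    ∑-spider-legs f = trans (∑-spider f)
      (cong (λ e → f zero + (e + ∑ (f ∘ index ∘ mid))) (∑-splitAt s (f ∘ index ∘ end)))

    -- The two vertices of a subdivided leg carry 1 each and so accompany one another even when the
    -- leg is cut off from the centre. The 2 at the centre dominates the outer feet. The weight is 2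
    -- + 2s.
    label : SpiderVertex (s + k) s → Fin 3
    label centre  = suc (suc zero)
    label (end i) = if toℕ i <ᵇ s then suc zero else zero
    label (mid j) = suc zero

    labelling : Labelling G
    labelling u = label (spiderVertex (s + k) s u)

    labelling-index : ∀ x → labelling (index x) ≡ label x
    labelling-index x = cong label (spiderVertex-index x)

    label-inner : ∀ {i} → toℕ i < s → label (end i) ≡ suc zero
    label-inner {i} i<s with toℕ i <ᵇ s | <⇒<ᵇ i<s
    ... | true | _ = refl

    label-outer : ∀ {i} → s ≤ toℕ i → label (end i) ≡ zero
    label-outer {i} s≤i with toℕ i <ᵇ s | centre-end {i} s≤i
    ... | false | _ = refl

    weight-labelling : weight G labelling ≡ 2 + (∑ {s} (λ _ → 1) + 0 + ∑ {s} (λ _ → 1))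
    weight-labelling = trans (∑-spider-legs (toℕ ∘ labelling)) (cong (2 +_) (cong₂ _+_ (cong₂ _+_
      (∑-cong λ j → cong toℕ (trans (labelling-index (inner j)) (label-inner (inner<s j))))
      (trans (∑-cong λ i → cong toℕ (trans (labelling-index (outer i)) (label-outer (s≤outer i)))) (∑-zero k)))
      (∑-cong λ j → cong toℕ (labelling-index (mid j)))))

  -- Each subdivided leg costs at least 2, and so do the centre and one outer
  -- foot together.
  labelling-minimal : 1 ≤ k → ∀ {f} → IsTRDF G f → weight G labelling ≤ weight G f
  labelling-minimal (s≤s {n = k′} _) {f} trdf = begin
    weight G labelling                                ≡⟨ weight-labelling ⟩
    2 + (∑ {s} (λ _ → 1) + 0 + ∑ {s} (λ _ → 1))       ≡⟨ cong (λ e → 2 + (e + ∑ {s} (λ _ → 1))) (+-identityʳ _) ⟩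
    2 + (∑ {s} (λ _ → 1) + ∑ {s} (λ _ → 1))           ≡⟨ cong (2 +_) (∑-+ {s} (λ _ → 1) (λ _ → 1)) ⟨
    2 + ∑ {s} (λ _ → 2)                               ≤⟨ +-mono-≤ hub legs ⟩
    (C + O) + ∑ (λ j → F (inner j) + F (mid j))       ≡⟨ cong ((C + O) +_) (∑-+ (F ∘ inner) (F ∘ mid)) ⟩
    (C + O) + (I + M)                                 ≡⟨ rearrange C O I M ⟩
    C + (I + O + M)                                   ≡⟨ ∑-spider-legs (toℕ ∘ f) ⟨
    weight G f                                        ∎
    where
    open ≤-Reasoning
    F : SpiderVertex (s + k) s → ℕ
    F = toℕ ∘ f ∘ index
    C O I M : ℕ
    C = F centre
    O = ∑ (F ∘ outer)
    I = ∑ (F ∘ inner)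
    M = ∑ (F ∘ mid)

    hub : 2 ≤ C + O
    hub = begin
      2                  ≤⟨ pendant+support≥2 G (outer-pendant (s ↑ʳ zero) (s≤outer zero)) trdf ⟩
      F (outer zero) + C ≤⟨ +-mono-≤ (term≤∑ (F ∘ outer) zero) ≤-refl ⟩
      O + C              ≡⟨ +-comm O C ⟩
      C + O              ∎

    legs : ∑ {s} (λ _ → 2) ≤ ∑ (λ j → F (inner j) + F (mid j))
    legs = ∑-mono λ j → pendant+support≥2 G (inner-pendant j) trdf

    rearrange : ∀ a b c d → (a + b) + (c + d) ≡ a + (c + b + d)
    rearrange = solve-∀

  -- Having no isolated vertices, `H` retains every pendant edge. Only the centre could then lack a
  -- positive neighbour, and the kept spoke provides one.
  labelling-TRDF : (H : Graph (suc (s + k + s))) → H ⊆ₑ G → NoIsolated H →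
    ∀ {j} → Adj H (index centre) (index (mid j)) → IsTRDF H labelling
  labelling-TRDF H H⊆G iso {j₀} kept = ∀-index dom , ∀-index tot
    where
    dom : ∀ x → toℕ (labelling (index x)) ≡ 0 → ∃[ u ] (Adj H (index x) u × toℕ (labelling u) ≡ 2)
    dom (mid j) eq = contradiction (trans (sym (cong toℕ (labelling-index (mid j)))) eq) λ ()
    dom (end i) eq with toℕ i <? s
    ... | yes i<s = contradiction
      (trans (sym (cong toℕ (trans (labelling-index (end i)) (label-inner i<s)))) eq) λ ()
    ... | no i≮s with iso (index (end i))
    ...   | u , e = u , e , cong (toℕ ∘ labelling) (outer-pendant i (≮⇒≥ i≮s) u (H⊆G _ _ e))

    tot : ∀ x → 0 < toℕ (labelling (index x)) → ∃[ u ] (Adj H (index x) u × 0 < toℕ (labelling u))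
    tot centre  _ = index (mid j₀) , kept , subst (λ l → 0 < toℕ l) (sym (labelling-index (mid j₀))) (s≤s z≤n)
    tot (end i) _ with iso (index (end i))
    ... | u , e = u , e , positive u (H⊆G _ _ e)
      where
      positive : ∀ u → Adj G (index (end i)) u → 0 < toℕ (labelling u)
      positive = ∀-index λ y e → subst (λ l → 0 < toℕ l) (sym (labelling-index y)) (lemma y (Adj-index⁻ (end i) y e))
        where
        lemma : ∀ y → T (spiderAdj (end i) y) → 0 < toℕ (label y)
        lemma centre  _ = s≤s z≤n
        lemma (mid _) _ = s≤s z≤n
    tot (mid j) _ with iso (index (inner j))
    ... | u , e = index (inner j) ,
      adj-flip H (subst (Adj H (index (inner j))) (inner-pendant j u (H⊆G _ _ e)) e) ,
      subst (λ l → 0 < toℕ l) (sym (trans (labelling-index (inner j)) (label-inner (inner<s j)))) (s≤s z≤n)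

  -- Two outer feet, available by `2 ≤ k`, are the required star leaves; the first subdivided leg,
  -- available by `1 ≤ s`, gives the pendant and its support.
  spokes-raise : 1 ≤ s → 2 ≤ k → Raises-γtR G spokes
  spokes-raise (s≤s {n = s′} _) (s≤s (s≤s {n = k′} _)) = starAt-raises G spider-iso (index centre) midAt (λ ())
    (λ {u} Bu → let j , eq = midAt⁻ u Bu in subst (Adj G (index centre)) eq (Adj-index⁺ centre (mid j) tt))
    (λ {u} Bu → let j , eq = midAt⁻ u Bu in index (inner j) , (λ ()) ,
      subst (λ u → Adj G u (index (inner j))) eq (Adj-index⁺ (mid j) (inner j) (mid-inner j)))
    (∀-index pendants)
    (λ eq → outer-≢ (index-injective eq))
    (Adj-index⁺ centre (outer zero) (centre-end (s≤outer zero))) (¬Bend (s ↑ʳ zero))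
    (Adj-index⁺ centre (outer (suc zero)) (centre-end (s≤outer (suc zero)))) (¬Bend (s ↑ʳ suc zero))
    {index (inner zero)} {index (mid zero)}
    (subst T (sym (midAt-index (mid zero))) tt)
    (inner-pendant zero)
    where
    ¬Bend : ∀ i → ¬ T (midAt (index (end i)))
    ¬Bend i = subst T (midAt-index (end i))

    outer-≢ : outer zero ≢ outer (suc zero)
    outer-≢ eq = contradiction (↑ʳ-injective s zero (suc zero) (end-injective eq)) λ ()
      where
      end-injective : ∀ {i j} → end {s + k} {s} i ≡ end j → i ≡ j
      end-injective refl = refl

    pendants : ∀ x → Adj G (index centre) (index x) → ¬ T (midAt (index x)) →
      ∀ u → Adj G (index x) u → u ≡ index centre
    pendants centre  ()
    pendants (end i) e _ = outer-pendant i (centre-end⁻ (Adj-index⁻ centre (end i) e))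
    pendants (mid j) _ ¬B = contradiction (subst T (sym (midAt-index (mid j))) tt) ¬B

    spider-iso : NoIsolated G
    spider-iso = ∀-index neighbour
      where
      neighbour : ∀ x → ∃[ u ] Adj G (index x) u
      neighbour centre  = index (mid zero) , Adj-index⁺ centre (mid zero) tt
      neighbour (mid j) = index centre , Adj-index⁺ (mid j) centre tt
      neighbour (end i) with toℕ i <? s
      ... | yes i<s = index (mid (fromℕ< i<s)) ,
        Adj-index⁺ (end i) (mid (fromℕ< i<s)) (≡⇒≡ᵇ _ _ (sym (toℕ-fromℕ< i<s)))
      ... | no i≮s = index centre , Adj-index⁺ (end i) centre (centre-end {i} (≮⇒≥ i≮s))

  -- If a spoke survived, `labelling` would be a TRDF of `G − E` no heavier than a minimum one of
  -- `G`. So `E` contains all `s` spokes.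
  Raises⇒s≤size : 1 ≤ k → ∀ E → Raises-γtR G E → s ≤ size E
  Raises⇒s≤size 1≤k E (E⊆G , iso , m , m′ , ((f , trdf , refl) , _) , (_ , min′) , m<m′)
    with any? (λ j → T? (adj (G − E) (index centre) (index (mid j))))
  ... | yes (j , kept) = contradiction m<m′ (≤⇒≯
    (≤-trans (min′ _ (labelling , labelling-TRDF (G − E) (−-⊆ G E) iso kept , refl)) (labelling-minimal 1≤k trdf)))
  ... | no cut = subst (_≤ size E) size-spokes (size-mono spokes E (starAt-⊆ (index centre) midAt (λ ()) E
    λ {u} Bu → let j , eq = midAt⁻ u Bu in subst (Adj E (index centre)) eq
      (decidable-stable (T? _) λ ¬e → cut (j , −-intro G E (Adj-index⁺ centre (mid j) tt) ¬e))))

  btR-spider : 1 ≤ s → 2 ≤ k → btR≡ G [ s ]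
  btR-spider 1≤s 2≤k =
    (spokes , spokes-raise 1≤s 2≤k , size-spokes) ,
    λ { _ (E , raises , refl) → Raises⇒s≤size (≤-trans (s≤s z≤n) 2≤k) E raises }

mainTheorem10 : (∀ {n} (T : Graph n) → IsTree T → (r x v : Fin n) → HeightOne T r x → Parent T r v x →
    (1 ≤ leavesAt T v → 2 ≤ leavesAt T x → btR≡ T [ 1 ]) ×
    (2 ≤ leavesAt T v → leavesAt T x ≡ 1 →
    ∃[ b ] (btR≡ T b × b ≤⁺ [ deg T v ∸ leavesAt T v ]))) ×
    (∀ t k → 3 ≤ t → 2 ≤ k → k ≤ t ∸ 1 → btR≡ (S k t) [ t ∸ k ])
mainTheorem10 =
  (λ T tree r x v height₁ parent →
    btR≡1 T tree height₁ parent , btR≤deg∸leavesAt T (proj₁ tree) (proj₁ parent)) ,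
  btR-S
  where
  btR-S : ∀ t k → 3 ≤ t → 2 ≤ k → k ≤ t ∸ 1 → btR≡ (S k t) [ t ∸ k ]
  btR-S (suc t) k _ 2≤k k≤t =
    -- Matching on `suc t` reduces the bound to `k ≤ t`, which makes `s` positive; the transport
    -- rewrites `s + k` as `suc t`.
    subst (λ t′ → btR≡ (spider t′ s) [ s ]) (m∸n+n≡m (m≤n⇒m≤1+n k≤t)) (btR-spider s k (m<n⇒0<n∸m (s≤s k≤t)) 2≤k)
    where
    s : ℕ
    s = suc t ∸ k
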